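{- Let $\mathbf{G}$ be a finite set of generalized path conditions and let $\sigma$ be a sequent. If $\mathrm{NCL}_{\mathbf{G}}\vdash\sigma$ (i.e. $\sigma$ has a proof in the labelled sequent calculus $\mathrm{NCL}_{\mathbf{G}}$), then $\sigma$ is valid over the class of $\mathbf{G}$-frames.
   Context: **Formulae and semantics.** Formulae are generated by $\varphi ::= \bot \mid p \mid (\varphi\to\varphi)\mid \triangle\varphi$, with $p$ in a countably infinite set $\mathsf{Prop}$ ($\triangle$ is the non-contingency operator). A frame is a pair $(W,R)$ with $W\neq\emptyset$ and $R\subseteq W\times W$. A model is $\mathcal{M}=(W,R,V)$ with $(W,R)$ a frame and $V:W\to 2^{\mathsf{Prop}}$. Truth $\mathcal{M},w\models\varphi$ is standard for $\bot$, atoms ($\mathcal{M},w\models p$ iff $p\in V(w)$) and $\to$; and $\mathcal{M},w\models\triangle\varphi$ iff either $\mathcal{M},v\models\varphi$ for all $v$ with $wRv$, or $\mathcal{M},v\not\models\varphi$ for all $v$ with $wRv$. **Words and generalized path conditions (GPCs).** Let $\Sigma=\{x,\overline{x}\}$ and let $\Sigma^*$ be the set of finite words over $\Sigma$, with empty word $\epsilon$. Converse: $\epsilon^{ -1}=\epsilon$, $x^{ -1}=\overline{x}$, $\overline{x}^{ -1}=x$, $(z_1\cdots z_n)^{ -1}=z_n^{ -1}\cdots z_1^{ -1}$. For a set $X$ (possibly empty) and $Q\subseteq X\times X$: $Q_\epsilon=\{(a,a)\mid a\in X\}$, $Q_x=Q$, $Q_{\overline{x}}=Q^{ -1}$, and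 $(a,b)\in Q_{z_1\cdots z_n}$ iff there are $a=a_0,\dots,a_n=b$ in $X$ with $(a_{i-1},a_i)\in Q_{z_i}$ for all $1\le i\le n$. A $\Sigma$-system $\mathcal{S}$ is a set of productions $z\mapsto\beta$ with $z\in\Sigma$, $\beta\in\Sigma^*$; $\rho z\tau\mapsto_{\mathcal{S}}\rho\eta\tau$ whenever $z\mapsto\eta\in\mathcal{S}$ and $\rho,\tau\in\Sigma^*$; $\mapsto_{\mathcal{S}}^*$ is the reflexive transitive closure; $\mathcal{L}_{\mathcal{S}}(\beta)=\{\gamma\mid\beta\mapsto^*_{\mathcal{S}}\gamma\}$. For $\alpha\in\Sigma^*$, $\mathcal{S}_\alpha=\{x\mapsto\alpha,\ \overline{x}\mapsto\alpha^{ -1}\}$. A frame $(W,R)$ satisfies the GPC $\mathbf{G}(\alpha)$ if $R_\beta\subseteq R$ for every $\beta\in\mathcal{L}_{\mathcal{S}_\alpha}(x)$. For a finite set $\mathbf{G}$ of GPCs, a $\mathbf{G}$-frame is a frame satisfying every member of $\mathbf{G}$, and $\mathcal{S}(\mathbf{G})=\bigcup_{\mathbf{G}(\alpha)\in\mathbf{G}}\mathcal{S}_\alpha$. **Sequents.** Let $\mathsf{Var}$ be a countably infinite set of variables (labels). A relational atom is an expression $\mathsf{x}\,\mathsf{R}\,\mathsf{y}$ and a labelled formula is an expression $\mathsf{x}:\varphi$, with $\mathsf{x},\mathsf{y}\in\mathsf{Var}$ and $\varphi$ a formula. A sequent $\sigma=\Omega\dashv\Gamma\Rightarrow\Delta$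 consists of a finite set $\Omega$ of relational atoms (the control) and finite sets $\Gamma,\Delta$ of labelled formulae. $\mathsf{Var}(\sigma)$ is the set of variables occurring in $\sigma$. For a model $\mathcal{M}=(W,R,V)$ and an assignment $\lambda:\mathsf{Var}\to W$: $\mathcal{M},\lambda\Vdash\mathsf{x}\,\mathsf{R}\,\mathsf{y}$ iff $\lambda(\mathsf{x})R\lambda(\mathsf{y})$; $\mathcal{M},\lambda\Vdash\mathsf{x}:\varphi$ iff $\mathcal{M},\lambda(\mathsf{x})\models\varphi$; and $\mathcal{M},\lambda\Vdash\sigma$ iff, whenever all members of $\Omega$ and all members of $\Gamma$ hold under $\mathcal{M},\lambda$, some member of $\Delta$ holds under $\mathcal{M},\lambda$. $\sigma$ is valid over a class of frames if $\mathcal{M},\lambda\Vdash\sigma$ for every model $\mathcal{M}$ based on a frame in the class and every assignment $\lambda$. **Closure of controls.** For $\sigma=\Omega\dashv\Gamma\Rightarrow\Delta$ put $X=\mathsf{Var}(\sigma)$ and $Q=\{(\mathsf{x},\mathsf{y})\mid \mathsf{x}\,\mathsf{R}\,\mathsf{y}\in\Omega\}\subseteq X\times X$. Then $\mathcal{S}(\mathbf{G})(\Omega)$ is the set of relational atoms $\mathsf{x}\,\mathsf{R}\,\mathsf{y}$ with $(\mathsf{x},\mathsf{y})\in\bigcup_{\beta\in\mathcal{L}_{\mathcal{S}(\mathbf{G})}(x)}Q_\beta$ (computed over the domain $X$). **The calculus $\mathrm{NCL}_{\mathbf{G}}$.** Commas denote set union. Initial sequents: $\Omega\dashv\Gamma,\mathsf{x}:\bot\Rightarrow\Delta$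 and $\Omega\dashv\Gamma,\mathsf{x}:\varphi\Rightarrow\mathsf{x}:\varphi,\Delta$. Rules (premises / conclusion): - ${\to}\mathsf{L}$: from $\Omega\dashv\Gamma\Rightarrow\mathsf{x}:\varphi,\Delta$ and $\Omega\dashv\Gamma,\mathsf{x}:\psi\Rightarrow\Delta$ infer $\Omega\dashv\Gamma,\mathsf{x}:\varphi\to\psi\Rightarrow\Delta$. - ${\to}\mathsf{R}$: from $\Omega\dashv\Gamma,\mathsf{x}:\varphi\Rightarrow\mathsf{x}:\psi,\Delta$ infer $\Omega\dashv\Gamma\Rightarrow\mathsf{x}:\varphi\to\psi,\Delta$. - $\triangle\mathsf{L}$: from $\Omega\dashv\Gamma,\mathsf{x}:\triangle\varphi,\{\mathsf{y}:\varphi\mid\mathsf{x}\,\mathsf{R}\,\mathsf{y}\in\Omega\}\Rightarrow\Delta$ and $\Omega\dashv\Gamma,\mathsf{x}:\triangle\varphi\Rightarrow\{\mathsf{y}:\varphi\mid\mathsf{x}\,\mathsf{R}\,\mathsf{y}\in\Omega\},\Delta$ infer $\Omega\dashv\Gamma,\mathsf{x}:\triangle\varphi\Rightarrow\Delta$. - $\triangle\mathsf{R}$: from $\Omega,\mathsf{x}\,\mathsf{R}\,\mathsf{y},\mathsf{x}\,\mathsf{R}\,\mathsf{z}\dashv\Gamma,\mathsf{y}:\varphi\Rightarrow\mathsf{z}:\varphi,\mathsf{x}:\triangle\varphi,\Delta$ infer $\Omega\dashv\Gamma\Rightarrow\mathsf{x}:\triangle\varphi,\Delta$, provided $\mathsf{y}\neq\mathsf{z}$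 and neither $\mathsf{y}$ nor $\mathsf{z}$ occurs in the conclusion. - $\mathsf{r}_{\mathbf{G}}$: from $\mathcal{S}(\mathbf{G})(\Omega)\dashv\Gamma\Rightarrow\Delta$ infer $\Omega\dashv\Gamma\Rightarrow\Delta$ (closure computed over the variables of the conclusion). A proof of $\sigma$ in $\mathrm{NCL}_{\mathbf{G}}$ is a finite tree labelled by sequents according to the rules, with root labelled $\sigma$ and every leaf labelled by an initial sequent. -}

module Defs where

open import Level using (Level; 0ℓ) renaming (suc to lsuc)
open import Data.Empty.Polymorphic using (⊥)
open import Data.List.Base using (List; []; _∷_; [_]; _++_; map; reverse; filter; concatMap)
open import Data.List.Membership.Propositional using (_∈_; _∉_)
open import Data.List.Relation.Binary.BagAndSetEquality using (_∼[_]_; set)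
open import Data.List.Relation.Unary.All using (All)
open import Data.List.Relation.Unary.Any using (Any)
open import Data.Nat.Base using (ℕ)
open import Data.Nat.Properties using (_≟_)
open import Data.Product.Base using (_×_; ∃-syntax)
open import Data.Refinement using (Refinement-syntax; value)
open import Data.Sum.Base using (_⊎_)
open import Function.Bundles using (_⇔_)
open import Relation.Binary.Construct.Closure.ReflexiveTransitive using (Star)
open import Relation.Binary.Core using (Rel; REL; _⇒_)
open import Relation.Binary.PropositionalEquality.Core using (_≡_; _≢_)
open import Relation.Nullary.Negation.Core using (¬_)
open import Relation.Unary using (Pred)

private
  variable
    a ℓ : Level

------------------------------------------------------------------------
-- Formulae and semantics

Atom : Set
Atom = ℕ

infix  30 △_
infixr 25 _⊃_

data Formula : Set where
  ⊥ᶠ   : Formula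
  atom : Atom → Formula
  _⊃_  : Formula → Formula → Formula
  △_   : Formula → Formula

record Frame ℓ : Set (lsuc ℓ) where
  field
    W        : Set ℓ
    nonempty : W
    R        : Rel W ℓ

record Model ℓ : Set (lsuc ℓ) where
  field
    frame : Frame ℓ
  open Frame frame public
  field
    V : W → Pred Atom ℓ

infix 4 _,_⊨_

_,_⊨_ : (M : Model ℓ) → Model.W M → Formula → Set ℓ
M , w ⊨ ⊥ᶠ      = ⊥
M , w ⊨ atom p  = Model.V M w p
M , w ⊨ (φ ⊃ ψ) = M , w ⊨ φ → M , w ⊨ ψ
M , w ⊨ (△ φ)   = (∀ v → Model.R M w v → M , v ⊨ φ)
                ⊎ (∀ v → Model.R M w v → ¬ (M , v ⊨ φ))

------------------------------------------------------------------------
-- Words and generalized path conditions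

data Letter : Set where
  ξ ξ̄ : Letter

Word : Set
Word = List Letter

convLetter : Letter → Letter
convLetter ξ = ξ̄
convLetter ξ̄ = ξ

infix 8 _⁻¹

_⁻¹ : Word → Word
β ⁻¹ = reverse (map convLetter β)

Step : {A : Set a} → Rel A a → Letter → Rel A a
Step Q ξ u v = Q u v
Step Q ξ̄ u v = Q v u

-- Path Q β is the relation Q_β on A.  For a one-letter word it is Step Q
-- of that letter, up to a trailing equality.
Path : {A : Set a} → Rel A a → Word → Rel A a
Path Q []      u v = u ≡ v
Path Q (z ∷ β) u v = ∃[ w ] (Step Q z u w × Path Q β w v)

System : Set₁
System = REL Letter Word 0ℓ

data Rewrite (S : System) : Rel Word 0ℓ where
  rewriteAt : ∀ ρ τ {z η} → S z η →
              Rewrite S (ρ ++ [ z ] ++ τ) (ρ ++ η ++ τ)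

ℒ : System → Word → Pred Word 0ℓ
ℒ S β γ = Star (Rewrite S) β γ

data 𝒮 (α : Word) : System where
  forward  : 𝒮 α ξ α
  backward : 𝒮 α ξ̄ (α ⁻¹)

-- The generalized path condition G(α).
record GPC : Set where
  constructor 𝐆
  field
    word : Word

-- A finite set of GPCs is given by a list; only membership in it matters.
GPCs : Set
GPCs = List GPC

systemOf : GPCs → System
systemOf Gs z β = ∃[ α ] (𝐆 α ∈ Gs × 𝒮 α z β)

SatisfiesGPC : Frame ℓ → GPC → Set ℓ
SatisfiesGPC F (𝐆 α) = ∀ β → ℒ (𝒮 α) [ ξ ] β → Path R β ⇒ R
  where open Frame F

IsGFrame : GPCs → Pred (Frame ℓ) ℓ
IsGFrame Gs F = All (SatisfiesGPC F) Gs

------------------------------------------------------------------------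
-- Sequents

Var : Set
Var = ℕ

infix 20 _ℛ_ _∶_

record RelAtom : Set where
  constructor _ℛ_
  field
    source target : Var

record LabelledFormula : Set where
  constructor _∶_
  field
    label   : Var
    formula : Formula

infix 4 _⊣_⇒ˢ_

-- The finite sets of a sequent are represented by lists.  Sequents are
-- identified up to _≋_ below, so order and repetition are irrelevant.
record Sequent : Set where
  constructor _⊣_⇒ˢ_
  field
    control    : List RelAtom
    antecedent : List LabelledFormula
    succedent  : List LabelledFormula

infix 3 _≋_

_≋_ : Rel Sequent 0ℓ
(Ω ⊣ Γ ⇒ˢ Δ) ≋ (Ω′ ⊣ Γ′ ⇒ˢ Δ′) =
  (Ω ∼[ set ] Ω′) × (Γ ∼[ set ] Γ′) × (Δ ∼[ set ] Δ′)

vars : Sequent → List Var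
vars (Ω ⊣ Γ ⇒ˢ Δ) =
  concatMap (λ (x ℛ y) → x ∷ y ∷ []) Ω
  ++ map LabelledFormula.label Γ
  ++ map LabelledFormula.label Δ

module _ (M : Model ℓ) (λᵛ : Var → Model.W M) where

  HoldsAtom : Pred RelAtom ℓ
  HoldsAtom (x ℛ y) = Model.R M (λᵛ x) (λᵛ y)

  HoldsFormula : Pred LabelledFormula ℓ
  HoldsFormula (x ∶ φ) = M , λᵛ x ⊨ φ

  HoldsSequent : Pred Sequent ℓ
  HoldsSequent (Ω ⊣ Γ ⇒ˢ Δ) =
    All HoldsAtom Ω → All HoldsFormula Γ → Any HoldsFormula Δ

ValidOver : Pred (Frame ℓ) ℓ → Pred Sequent (lsuc ℓ)
ValidOver {ℓ} C σ =
  (M : Model ℓ) → C (Model.frame M) →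
  (λᵛ : Var → Model.W M) → HoldsSequent M λᵛ σ

------------------------------------------------------------------------
-- Closure of controls

Dom : Sequent → Set
Dom σ = [ x ∈ Var ∣ x ∈ vars σ ]

Control : ∀ σ → Rel (Dom σ) 0ℓ
Control σ u v = value u ℛ value v ∈ Sequent.control σ

-- Restricting to Dom σ matters for the empty word: x ℛ x is added only for
-- variables x of σ.
data Closure (Gs : GPCs) (σ : Sequent) : Pred RelAtom 0ℓ where
  closure : ∀ {β} (u v : Dom σ) → ℒ (systemOf Gs) [ ξ ] β →
            Path (Control σ) β u v → Closure Gs σ (value u ℛ value v)

------------------------------------------------------------------------
-- The calculus

-- The labelled formulae y ∶ φ with x ℛ y in the given control.
successors : Var → Formula → List RelAtom → List LabelledFormula
successors x φ Ω =
  map (λ r → RelAtom.target r ∶ φ) (filter (λ r → RelAtom.source r ≟ x) Ω)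

infix 3 NCL[_]⊢_

data NCL[_]⊢_ (Gs : GPCs) : Pred Sequent 0ℓ where

  -- Not a rule of the calculus: it identifies lists representing the same
  -- finite sets.
  resp-≋ : ∀ {σ σ′} → σ ≋ σ′ → NCL[ Gs ]⊢ σ → NCL[ Gs ]⊢ σ′

  init-⊥ : ∀ {Ω Γ Δ x} →
    NCL[ Gs ]⊢ Ω ⊣ x ∶ ⊥ᶠ ∷ Γ ⇒ˢ Δ

  init : ∀ {Ω Γ Δ x φ} →
    NCL[ Gs ]⊢ Ω ⊣ x ∶ φ ∷ Γ ⇒ˢ x ∶ φ ∷ Δ

  ⊃L : ∀ {Ω Γ Δ x φ ψ} →
    NCL[ Gs ]⊢ Ω ⊣ Γ ⇒ˢ x ∶ φ ∷ Δ →
    NCL[ Gs ]⊢ Ω ⊣ x ∶ ψ ∷ Γ ⇒ˢ Δ →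
    NCL[ Gs ]⊢ Ω ⊣ x ∶ (φ ⊃ ψ) ∷ Γ ⇒ˢ Δ

  ⊃R : ∀ {Ω Γ Δ x φ ψ} →
    NCL[ Gs ]⊢ Ω ⊣ x ∶ φ ∷ Γ ⇒ˢ x ∶ ψ ∷ Δ →
    NCL[ Gs ]⊢ Ω ⊣ Γ ⇒ˢ x ∶ (φ ⊃ ψ) ∷ Δ

  △L : ∀ {Ω Γ Δ x φ} →
    NCL[ Gs ]⊢ Ω ⊣ successors x φ Ω ++ x ∶ △ φ ∷ Γ ⇒ˢ Δ →
    NCL[ Gs ]⊢ Ω ⊣ x ∶ △ φ ∷ Γ ⇒ˢ successors x φ Ω ++ Δ →
    NCL[ Gs ]⊢ Ω ⊣ x ∶ △ φ ∷ Γ ⇒ˢ Δ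

  △R : ∀ {Ω Γ Δ x y z φ} →
    y ≢ z →
    y ∉ vars (Ω ⊣ Γ ⇒ˢ x ∶ △ φ ∷ Δ) →
    z ∉ vars (Ω ⊣ Γ ⇒ˢ x ∶ △ φ ∷ Δ) →
    NCL[ Gs ]⊢ x ℛ y ∷ x ℛ z ∷ Ω ⊣ y ∶ φ ∷ Γ ⇒ˢ z ∶ φ ∷ x ∶ △ φ ∷ Δ →
    NCL[ Gs ]⊢ Ω ⊣ Γ ⇒ˢ x ∶ △ φ ∷ Δ

  -- Ω⁺ is any list enumerating the closure of Ω over the conclusion's
  -- variables.
  rG : ∀ {Ω Ω⁺ Γ Δ} →
    (∀ r → r ∈ Ω⁺ ⇔ Closure Gs (Ω ⊣ Γ ⇒ˢ Δ) r) →
    NCL[ Gs ]⊢ Ω⁺ ⊣ Γ ⇒ˢ Δ →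
    NCL[ Gs ]⊢ Ω ⊣ Γ ⇒ˢ Δ

{-# OPTIONS --safe #-}

-- By induction on the proof.  For r_G: if R_α ⊆ R, then also R_{α⁻¹} ⊆ R⁻¹, so
-- every rewriting step γ ↦ δ with a production of S(G) gives R_δ ⊆ R_γ.  Hence
-- R_β ⊆ R for each β derivable from x, even when the productions come from
-- different members of G.  For △R: if △φ fails at λ(x), some successor v satisfies
-- φ and some successor w does not, and the premise is applied to λ[y ↦ v][z ↦ w].
module Submission where

open import Defs
open import Axiom.ExcludedMiddle using (ExcludedMiddle)

open import Level using (Level)
open import Data.List.Base using (List; []; _∷_; _++_; concatMap; map)
open import Data.List.Membership.Propositional using (_∈_; find; lose)
open import Data.List.Membership.Propositional.Properties
  using (∈-++⁺ˡ; ∈-++⁺ʳ; ∈-map⁺; ∈-concatMap⁺; ∈-map∘filter⁻)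
open import Data.List.Properties using (unfold-reverse)
open import Data.List.Relation.Binary.BagAndSetEquality using (_∼[_]_; set)
open import Data.List.Relation.Unary.All as All using (All; []; _∷_)
import Data.List.Relation.Unary.All.Properties as All
open import Data.List.Relation.Unary.Any as Any using (Any; here; there)
import Data.List.Relation.Unary.Any.Properties as Any
open import Data.Nat.Properties using (_≟_)
open import Data.Product.Base using (_×_; _,_; ∃-syntax)
open import Data.Refinement using (value)
open import Data.Sum.Base using (inj₁; inj₂; [_,_])
open import Function.Base using (_∘_)
open import Function.Bundles using (module Equivalence)
open import Function.Construct.Symmetry using (⇔-sym)
open import Relation.Binary.Construct.Closure.ReflexiveTransitive using (ε; _◅_)
open import Relation.Binary.Core using (Rel; _⇒_)
open import Relation.Binary.PropositionalEquality
  using (_≡_; _≢_; refl; sym; trans; subst; subst₂)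
open import Relation.Nullary.Decidable using (yes; no; decidable-stable)
open import Relation.Nullary.Negation using (¬_; contradiction)
open import Relation.Unary using (Pred; _⊆_)

open Equivalence using (to; from)

private
  variable
    a b ℓ p : Level
    A : Set a
    B : Set b

Path-++⁺ : {Q : Rel A ℓ} (β : Word) {γ : Word} {u v w : A} →
           Path Q β u v → Path Q γ v w → Path Q (β ++ γ) u w
Path-++⁺ []      refl        q = q
Path-++⁺ (z ∷ β) (_ , s , p) q = _ , s , Path-++⁺ β p q

Path-++⁻ : {Q : Rel A ℓ} (β : Word) {γ : Word} {u w : A} →
           Path Q (β ++ γ) u w → ∃[ v ] (Path Q β u v × Path Q γ v w)
Path-++⁻ []      q           = _ , refl , q
Path-++⁻ (z ∷ β) (_ , s , p) with Path-++⁻ β p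
... | v , p₁ , p₂ = v , (_ , s , p₁) , p₂

Step-conv : {Q : Rel A ℓ} (z : Letter) {u v : A} →
            Step Q (convLetter z) u v → Step Q z v u
Step-conv ξ s = s
Step-conv ξ̄ s = s

-- The converse of `z ∷ β` ends in the converse of `z`; splitting off that last step and reversing
-- it gives the first step of the reversed path.
Path-⁻¹ : {Q : Rel A ℓ} (β : Word) {u v : A} → Path Q (β ⁻¹) u v → Path Q β v u
Path-⁻¹ []      refl = refl
Path-⁻¹ {Q = Q} (z ∷ β) {u} {v} q
  with Path-++⁻ (β ⁻¹)
         (subst (λ γ → Path Q γ u v) (unfold-reverse (convLetter z) (map convLetter β)) q)
... | w , q′ , _ , s , refl = w , Step-conv z s , Path-⁻¹ β q′

Step-map : {P : Rel A ℓ} {Q : Rel B p} (f : A → B) →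
           (∀ {u v} → P u v → Q (f u) (f v)) →
           ∀ z {u v} → Step P z u v → Step Q z (f u) (f v)
Step-map f P⇒Q ξ s = P⇒Q s
Step-map f P⇒Q ξ̄ s = P⇒Q s

-- Carries paths through the control of a sequent, under an assignment, to paths in the frame.
Path-map : {P : Rel A ℓ} {Q : Rel B p} (f : A → B) →
           (∀ {u v} → P u v → Q (f u) (f v)) →
           ∀ β {u v} → Path P β u v → Path Q β (f u) (f v)
Path-map f P⇒Q []      refl        = refl
Path-map f P⇒Q (z ∷ β) (w , s , p) = f w , Step-map f P⇒Q z s , Path-map f P⇒Q β p

module _ {Q : Rel A ℓ} {S : System}
         (production : ∀ {z η} → S z η → Path Q η ⇒ Step Q z) where

  -- The segment of the path that reads `η` contracts to a single `z`-step; the segments for `ρ` and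
  -- `τ` stay as they are.
  Rewrite-sound : ∀ {β γ} → Rewrite S β γ → Path Q γ ⇒ Path Q β
  Rewrite-sound (rewriteAt ρ τ {η = η} r) q with Path-++⁻ ρ q
  ... | _ , q₁ , q₂ with Path-++⁻ η q₂
  ... | _ , q₃ , q₄ = Path-++⁺ ρ q₁ (_ , production r q₃ , q₄)

  ℒ-sound : ∀ {β γ} → ℒ S β γ → Path Q γ ⇒ Path Q β
  ℒ-sound ε        q = q
  ℒ-sound (r ◅ rs) q = Rewrite-sound r (ℒ-sound rs q)

module _ {F : Frame ℓ} where
  open Frame F

  SatisfiesGPC⇒⊆ : ∀ {α} → SatisfiesGPC F (𝐆 α) → Path R α ⇒ R
  SatisfiesGPC⇒⊆ {α} sat q =
    -- One rewrite of `ξ` in empty contexts yields `α ++ []`, so the given path is prolonged by the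
    -- empty one.
    sat (α ++ []) (rewriteAt [] [] forward ◅ ε) (Path-++⁺ α q refl)

  -- Each production comes from one member of `Gs`, whose own condition suffices for it. The
  -- backward case is the forward one read along the reversed path.
  systemOf-sound : ∀ {Gs} → IsGFrame Gs F →
                   ∀ {z η} → systemOf Gs z η → Path R η ⇒ Step R z
  systemOf-sound gf (α , α∈ , forward)  q = SatisfiesGPC⇒⊆ (All.lookup gf α∈) q
  systemOf-sound gf (α , α∈ , backward) q = SatisfiesGPC⇒⊆ (All.lookup gf α∈) (Path-⁻¹ α q)

Closure-sound : (M : Model ℓ) (λᵛ : Var → Model.W M) {Gs : GPCs} →
                IsGFrame Gs (Model.frame M) → ∀ {σ} →
                All (HoldsAtom M λᵛ) (Sequent.control σ) →
                Closure Gs σ ⊆ HoldsAtom M λᵛ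
Closure-sound M λᵛ gf hΩ (closure {β} u v d q)
  with ℒ-sound (systemOf-sound {F = Model.frame M} gf) d
         (Path-map (λᵛ ∘ value) (All.lookup hΩ) β q)
-- The path for `β` has been contracted to one for `[ ξ ]`: a single step `s` and a trailing
-- equality.
... | _ , s , refl = s

All-resp-set : {P : Pred A p} {xs ys : List A} → xs ∼[ set ] ys → All P xs → All P ys
All-resp-set xs∼ys pxs = All.tabulate λ y∈ → All.lookup pxs (from xs∼ys y∈)

Any-resp-set : {P : Pred A p} {xs ys : List A} → xs ∼[ set ] ys → Any P xs → Any P ys
Any-resp-set xs∼ys pxs with find pxs
... | _ , x∈ , px = lose (to xs∼ys x∈) px

_[_↦_] : (Var → A) → Var → A → Var → A
(f [ y ↦ w ]) x with x ≟ y
... | yes _ = w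
... | no  _ = f x

update-≡ : (f : Var → A) (y : Var) (w : A) → (f [ y ↦ w ]) y ≡ w
update-≡ f y w with y ≟ y
... | yes _  = refl
... | no y≢y = contradiction refl y≢y

update-≢ : (f : Var → A) {x y : Var} (w : A) → x ≢ y → (f [ y ↦ w ]) x ≡ f x
update-≢ f {x} {y} w x≢y with x ≟ y
... | yes x≡y = contradiction x≡y x≢y
... | no  _   = refl

module _ (σ : Sequent) where
  open LabelledFormula using (label)
  open RelAtom using (source; target)
  open Sequent σ

  source∈vars : ∀ {r} → r ∈ control → source r ∈ vars σ
  source∈vars r∈ = ∈-++⁺ˡ (∈-concatMap⁺ _ (lose r∈ (here refl)))

  target∈vars : ∀ {r} → r ∈ control → target r ∈ vars σ
  target∈vars r∈ = ∈-++⁺ˡ (∈-concatMap⁺ _ (lose r∈ (there (here refl))))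

  antecedent∈vars : ∀ {f} → f ∈ antecedent → label f ∈ vars σ
  antecedent∈vars f∈ = ∈-++⁺ʳ (concatMap _ control) (∈-++⁺ˡ (∈-map⁺ label f∈))

  succedent∈vars : ∀ {f} → f ∈ succedent → label f ∈ vars σ
  succedent∈vars f∈ =
    ∈-++⁺ʳ (concatMap _ control) (∈-++⁺ʳ (map label antecedent) (∈-map⁺ label f∈))

  module _ (M : Model ℓ) {λ₁ λ₂ : Var → Model.W M}
           (agree : ∀ {x} → x ∈ vars σ → λ₁ x ≡ λ₂ x) where

    -- Truth of the sequent's parts depends only on the values at its variables, so reassigning
    -- fresh variables in `△R` does no harm.
    control-cong : All (HoldsAtom M λ₁) control → All (HoldsAtom M λ₂) control
    control-cong hΩ = All.tabulate λ r∈ → subst₂ (Model.R M)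
      (agree (source∈vars r∈)) (agree (target∈vars r∈)) (All.lookup hΩ r∈)

    antecedent-cong : All (HoldsFormula M λ₁) antecedent → All (HoldsFormula M λ₂) antecedent
    antecedent-cong hΓ = All.tabulate λ {(_ ∶ φ)} f∈ →
      subst (M ,_⊨ φ) (agree (antecedent∈vars f∈)) (All.lookup hΓ f∈)

    succedent-cong : Any (HoldsFormula M λ₁) succedent → Any (HoldsFormula M λ₂) succedent
    succedent-cong hΔ with find hΔ
    ... | _ ∶ φ , f∈ , h = lose f∈ (subst (M ,_⊨ φ) (agree (succedent∈vars f∈)) h)

-- `P` is arbitrary because `△L` uses it both for truth and for falsity of the successor formulae.
successors⁺ : {P : Pred LabelledFormula p} (x : Var) (φ : Formula) (Ω : List RelAtom) →
              (∀ {y} → x ℛ y ∈ Ω → P (y ∶ φ)) → All P (successors x φ Ω)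
successors⁺ {P = P} x φ Ω h = All.tabulate holds
  where
  holds : ∀ {f} → f ∈ successors x φ Ω → P f
  holds f∈ with ∈-map∘filter⁻ (λ r → RelAtom.target r ∶ φ) (λ r → RelAtom.source r ≟ x) f∈
  ... | _ , r∈ , refl , refl = h r∈

-- Either no successor satisfies `φ`, or some `v` does; comparing any other successor with `v` then
-- forces `φ` there too.
△-intro : ExcludedMiddle ℓ → (M : Model ℓ) {u : Model.W M} (φ : Formula) →
          (∀ {v w} → Model.R M u v → Model.R M u w → M , v ⊨ φ → ¬ ¬ (M , w ⊨ φ)) → M , u ⊨ △ φ
△-intro em M {u} φ h with em {∀ v → Model.R M u v → ¬ (M , v ⊨ φ)}
... | yes none = inj₂ none
... | no ¬none = inj₁ λ w Ruw → decidable-stable em λ ¬hw →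
                   ¬none λ v Ruv hv → h Ruv Ruw hv ¬hw

module _ (em : ExcludedMiddle ℓ) (M : Model ℓ) {Gs : GPCs}
         (gf : IsGFrame Gs (Model.frame M)) where

  -- The assignment is quantified inside the induction, since `△R` applies the hypothesis to an
  -- updated one.
  soundness : ∀ {σ} → NCL[ Gs ]⊢ σ → ∀ λᵛ → HoldsSequent M λᵛ σ
  soundness (resp-≋ (Ω∼ , Γ∼ , Δ∼) d) λᵛ hΩ hΓ =
    Any-resp-set Δ∼ (soundness d λᵛ (All-resp-set (⇔-sym Ω∼) hΩ) (All-resp-set (⇔-sym Γ∼) hΓ))
  soundness init-⊥ λᵛ hΩ (() ∷ _)
  soundness init λᵛ hΩ (h ∷ _) = here h
  soundness (⊃L d e) λᵛ hΩ (h ∷ hΓ) with soundness d λᵛ hΩ hΓ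
  ... | here hφ  = soundness e λᵛ hΩ (h hφ ∷ hΓ)
  ... | there hΔ = hΔ
  -- The premise can be used only once `φ` holds at `λᵛ x`; otherwise the implication is vacuously
  -- true.
  soundness (⊃R {x = x} {φ} d) λᵛ hΩ hΓ with em {M , λᵛ x ⊨ φ}
  ... | no ¬hφ = here λ hφ → contradiction hφ ¬hφ
  ... | yes hφ with soundness d λᵛ hΩ (hφ ∷ hΓ)
  ...   | here hψ  = here λ _ → hψ
  ...   | there hΔ = there hΔ
  soundness (△L {Ω} {x = x} {φ} d e) λᵛ hΩ (inj₁ all ∷ hΓ) =
    soundness d λᵛ hΩ
      (All.++⁺ (successors⁺ x φ Ω λ r∈ → all _ (All.lookup hΩ r∈)) (inj₁ all ∷ hΓ))
  -- All successors falsify `φ`, so the true formula supplied by the second premise must lie in `Δ`.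
  soundness (△L {Ω} {x = x} {φ} d e) λᵛ hΩ (inj₂ none ∷ hΓ)
    with Any.++⁻ (successors x φ Ω) (soundness e λᵛ hΩ (inj₂ none ∷ hΓ))
  ... | inj₁ hS = contradiction hS
    (All.All¬⇒¬Any (successors⁺ x φ Ω λ r∈ → none _ (All.lookup hΩ r∈)))
  ... | inj₂ hΔ = hΔ
  soundness (△R {Ω} {Γ} {Δ} {x} {y} {z} {φ} y≢z y∉ z∉ d) λᵛ hΩ hΓ =
    -- By contradiction: if the whole succedent fails, no two successors disagree on `φ`, so `△ φ`
    -- itself holds.
    decidable-stable em λ ¬hΔ → ¬hΔ (here (△-intro em M φ λ Rv Rw hv ¬hw →
      ¬hΔ (separated Rv Rw hv ¬hw)))
    where
    open Model M using (W; R)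

    σ : Sequent
    σ = Ω ⊣ Γ ⇒ˢ x ∶ △ φ ∷ Δ

    -- Under `λ′` the formula `z ∶ φ` fails, so the premise makes some formula of the conclusion's
    -- succedent true; freshness of `y` and `z` moves it back to `λᵛ`.
    separated : ∀ {v w} → R (λᵛ x) v → R (λᵛ x) w → M , v ⊨ φ → ¬ (M , w ⊨ φ) →
                Any (HoldsFormula M λᵛ) (x ∶ △ φ ∷ Δ)
    separated {v} {w} Rv Rw hv ¬hw =
      [ (λ hz → contradiction (subst (M ,_⊨ φ) z≡ hz) ¬hw)
      , succedent-cong σ M (sym ∘ agree)
      ] (Any.toSum (soundness d λ′
          (subst₂ R x≡ (sym y≡) Rv ∷ subst₂ R x≡ (sym z≡) Rw ∷
             control-cong σ M agree hΩ)
          (subst (M ,_⊨ φ) (sym y≡) hv ∷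
             antecedent-cong σ M agree hΓ)))
      where
      λ′ : Var → W
      λ′ = (λᵛ [ y ↦ v ]) [ z ↦ w ]

      agree : ∀ {t} → t ∈ vars σ → λᵛ t ≡ λ′ t
      agree t∈ = sym (trans
        (update-≢ (λᵛ [ y ↦ v ]) w (λ t≡z → z∉ (subst (_∈ _) t≡z t∈)))
        (update-≢ λᵛ v (λ t≡y → y∉ (subst (_∈ _) t≡y t∈))))

      x≡ : λᵛ x ≡ λ′ x
      x≡ = agree (succedent∈vars σ (here refl))

      y≡ : λ′ y ≡ v
      -- The update at `z` is outermost and leaves `y` alone because `y ≢ z`.
      y≡ = trans (update-≢ (λᵛ [ y ↦ v ]) w y≢z) (update-≡ λᵛ y v)

      z≡ : λ′ z ≡ w
      z≡ = update-≡ (λᵛ [ y ↦ v ]) z w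
  soundness (rG closed d) λᵛ hΩ hΓ =
    soundness d λᵛ (All.tabulate λ r∈ → Closure-sound M λᵛ gf hΩ (to (closed _) r∈)) hΓ

mainTheorem1 : ∀ {ℓ} → ExcludedMiddle ℓ →
    (Gs : GPCs) (σ : Sequent) →
    NCL[ Gs ]⊢ σ → ValidOver {ℓ} (IsGFrame Gs) σ
mainTheorem1 em Gs σ d M gf λᵛ = soundness em M gf d λᵛ
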